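{- (M-UR) Let $Q:M\to M\to\mathrm{Set}$ be any relation. Then the following type is inhabited: $$\prod_{a:M}\left[\left(\prod_{i:T\bar a}\ \sum_{b:M}\ \prod_{y:M}\bigl(y\in b\;\simeq\;Q\,(\tilde a\,i)\,y\bigr)\right)\;\to\;\sum_{c:M}\ \prod_{y:M}\Bigl(y\in c\;\simeq\;\sum_{i:T\bar a}Q\,(\tilde a\,i)\,y\Bigr)\right].$$
   Context: The setting is Martin-Löf (homotopy/univalent) type theory with the Univalence Axiom (hence function extensionality); $A:\mathrm{Set}$ means "$A$ is a type" (not necessarily a 0-type), and $A\simeq B$ is the type of equivalences as in the Homotopy Type Theory book. $U:\mathrm{Set}$ is a univalent universe with decoding function $T:U\to\mathrm{Set}$; univalent means that for $a,b:U$ the canonical map $\mathrm{Id}_U\,a\,b\to (T\,a\simeq T\,b)$ is an equivalence. $U$ is assumed closed under $+$, $\Sigma$-, $\Pi$- and identity types. $M := W_{a:U}\,T\,a$ is the W-type with canonical elements $\sup\,a\,f$, where $a:U$ and $f:T\,a\to M$. For $x:M$, the index $\bar x:U$ and the map $\tilde x:T\,\bar x\to M$ are given by $\overline{\sup\,a\,f}\equiv a$ and $\widetilde{\sup\,a\,f}\equiv f$. The relation $=_M\,:M\to M\to\mathrm{Set}$ is defined by recursion: $$(\sup\,a\,f)=_M(\sup\,b\,g)\;:=\;\sum_{\alpha:T a\simeq T b}\ \prod_{x:T a}\ (f\,x)=_M\bigl(g\,(\alpha\,x)\bigr).$$ The relation $\in\,:M\to M\to\mathrm{Set}$ is defined by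 $$x\in(\sup\,b\,g)\;:=\;\sum_{i:T b}\ x=_M(g\,i).$$ -}

{-# OPTIONS --without-K #-}
module Defs where

open import Level using (Level; _⊔_)
open import Data.Container.Core using (_▷_)
open import Data.Product.Base using (Σ; Σ-syntax; _,_)
open import Data.Sum.Base using (_⊎_)
open import Data.W using (W; sup)
open import Function.Base using (id; _∘_)
open import Function.Properties.Inverse.HalfAdjointEquivalence using (_≃_)
open import Relation.Binary.PropositionalEquality.Core using (_≡_; refl; cong)

private
  variable
    ℓ ℓ′ : Level

-- The fields are those of _≃_ other than the underlying map, so A ≃ B is
-- Σ (A → B) IsEquiv in record form.
record IsEquiv {A : Set ℓ} {B : Set ℓ′} (f : A → B) : Set (ℓ ⊔ ℓ′) where
  field
    from             : B → A
    left-inverse-of  : ∀ x → from (f x) ≡ x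
    right-inverse-of : ∀ y → f (from y) ≡ y
    left-right       : ∀ x → cong f (left-inverse-of x) ≡ right-inverse-of (f x)

id≃ : {A : Set ℓ} → A ≃ A
id≃ = record
  { to               = id
  ; from             = id
  ; left-inverse-of  = λ _ → refl
  ; right-inverse-of = λ _ → refl
  ; left-right       = λ _ → refl
  }

≡⇒≃ : {U : Set ℓ} (T : U → Set ℓ′) {a b : U} → a ≡ b → T a ≃ T b
≡⇒≃ T refl = id≃

IsUnivalent : {U : Set ℓ} → (U → Set ℓ′) → Set (ℓ ⊔ ℓ′)
IsUnivalent {U = U} T = (a b : U) → IsEquiv (≡⇒≃ T {a} {b})

-- The Univalence Axiom for the ambient universe Set. It contradicts axiom K,
-- so it is only meaningful together with --without-K.
Univalence : Set₁
Univalence = IsUnivalent {U = Set} id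

-- The decoding equations are propositional, since a hypothesis cannot
-- express judgemental equality.
record IsClosed {U : Set} (T : U → Set) : Set₁ where
  field
    plus  : U → U → U
    sigma : (a : U) → (T a → U) → U
    pi    : (a : U) → (T a → U) → U
    ident : (a : U) → T a → T a → U

    T-plus  : ∀ a b → T (plus a b) ≡ (T a ⊎ T b)
    T-sigma : ∀ a b → T (sigma a b) ≡ Σ (T a) (T ∘ b)
    T-pi    : ∀ a b → T (pi a b) ≡ ((x : T a) → T (b x))
    T-ident : ∀ a x y → T (ident a x y) ≡ (x ≡ y)

module IterativeMultiset {U : Set} (T : U → Set) where

  infix 4 _=M_ _∈_

  -- For x : M, the index and the map of x are Data.W.head x and Data.W.tail x.
  M : Set
  M = W (U ▷ T)

  _=M_ : M → M → Set
  sup (a , f) =M sup (b , g) =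
    Σ[ α ∈ T a ≃ T b ] ((x : T a) → f x =M g (_≃_.to α x))

  _∈_ : M → M → Set
  x ∈ sup (b , g) = Σ[ i ∈ T b ] (x =M g i)

{-# OPTIONS --without-K #-}
module Submission where

-- Call b i the multiset given by the hypothesis for i : T (head a). The
-- multiset c is the indexed union of the b i: its index type is the type of
-- pairs of an i and an index of b i, which has a code in U by closure under
-- Σ. Membership in a union is a Σ-type of memberships (∈-⋃), because
--
--   y ∈ c  ≃  Σ (i , j) , y =M tail (b i) j
--          ≃  Σ i , Σ j , y =M tail (b i) j
--          ≃  Σ i , y ∈ b i,
--
-- and the last type is equivalent to Σ i , Q (tail a i) y fibre by fibre.

open import Defs
open import Data.Product.Algebra using (Σ-assoc-alt)
open import Data.Product.Base using (Σ; Σ-syntax; _,_; proj₁; proj₂; uncurry)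
open import Data.Product.Function.Dependent.Propositional using (Σ-↔)
open import Data.W using (head; tail; sup)
open import Function.Base using (_∘_)
open import Function.Bundles using (_↔_; module Inverse)
open import Function.Properties.Inverse using (↔-refl; ↔-trans)
open import Function.Properties.Inverse.HalfAdjointEquivalence
  using (_≃_; ≃⇒↔; ↔⇒≃)
open import Function.Related.Propositional using (≡⇒; bijection)

module IndexedUnion {U : Set} (T : U → Set) (closed : IsClosed T) where

  open IterativeMultiset T
  open IsClosed closed using (sigma; T-sigma)

  sigma-↔ : (u : U) (v : T u → U) → T (sigma u v) ↔ Σ (T u) (T ∘ v)
  sigma-↔ u v = ≡⇒ {k = bijection} (T-sigma u v)

  -- The multiset whose elements are those of all the b i, multiplicities
  -- being added. The code sigma decodes to a Σ-type only up to a propositional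
  -- equality, so indices are read through sigma-↔.
  ⋃ : (u : U) (b : T u → M) → M
  ⋃ u b = sup ( sigma u (head ∘ b)
              , uncurry (tail ∘ b) ∘ Inverse.to (sigma-↔ u (head ∘ b)) )

  -- The definition of membership for a multiset not presented as a sup.
  ∈-tail : (x y : M) → (Σ[ j ∈ T (head x) ] (y =M tail x j)) ↔ (y ∈ x)
  ∈-tail (sup _) y = ↔-refl

  ∈-⋃ : (u : U) (b : T u → M) (y : M) → (y ∈ ⋃ u b) ↔ (Σ[ i ∈ T u ] (y ∈ b i))
  ∈-⋃ u b y =
    ↔-trans (Σ-↔ {B = λ p → y =M uncurry (tail ∘ b) p}
                 (sigma-↔ u (head ∘ b)) ↔-refl)
    (↔-trans Σ-assoc-alt
             (Σ-↔ ↔-refl (λ {i} → ∈-tail (b i) y)))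

proposition4 : Univalence →
    (U : Set) (T : U → Set) → IsUnivalent T → IsClosed T →
    let open IterativeMultiset T in
    (Q : M → M → Set) →
    (a : M) →
    ((i : T (head a)) → Σ[ b ∈ M ] ((y : M) → (y ∈ b) ≃ Q (tail a i) y)) →
    Σ[ c ∈ M ] ((y : M) → (y ∈ c) ≃ (Σ[ i ∈ T (head a) ] Q (tail a i) y))
proposition4 _ U T _ closed Q a image =
  ⋃ (head a) b , λ y →
    ↔⇒≃ (↔-trans (∈-⋃ (head a) b y)
                 (Σ-↔ ↔-refl (λ {i} → ≃⇒↔ (proj₂ (image i) y))))
  where
  open IterativeMultiset T
  open IndexedUnion T closed

  b : T (head a) → M
  b i = proj₁ (image i)
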